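{- For all closed indecomposable planar lambda terms $M$, the binding tree $\gamma^T[M]$ is below the application tree $\alpha[M]$ in the Tamari order, i.e. $\gamma^T[M] \le \alpha[M]$.
   Context: Lambda terms: a term is a variable $x$, an application $M(N)$, or an abstraction $\lambda x.M$; terms are considered up to $\alpha$-conversion, with representatives chosen so that all bound variables have distinct names and no variable is both free and bound. Subterms are defined as usual (a term is a subterm of itself). A term is linear if in every abstraction subterm $\lambda x.M$ the variable $x$ has exactly one free occurrence in $M$, and every free variable of the term occurs exactly once. A term is closed if it has no free variables, and indecomposable if it has no closed proper subterms. A closed indecomposable term is necessarily an abstraction $\lambda x.M$ with $M$ indecomposable. The binding diagram of a linear term is the word $\gamma[M]$ defined by $\gamma[x] = x$, $\gamma[M(N)] = \gamma[M],\gamma[N]$, $\gamma[\lambda x.M] = x,\gamma[M]$. A double-occurrence word is a (possibly empty) word in which each occurring letter occurs exactly twice. A linear term $M$ is planar if whenever $x,\delta,x$ is a contiguous subword of $\gamma[M]$ with $x$ a letter, $\delta$ is a double-occurrence word. Leaf-labelled binary trees (formulas) are generated by: each variable $x$ is a tree (a leaf), and if $A,B$ are trees so is $A*B$. The frontier $\mathrm{fr}(A)$ is the list of leaf labels: $\mathrm{fr}(x)=x$, $\mathrm{fr}(A*B)=\mathrm{fr}(A),\mathrm{fr}(B)$. The Tamari order $\le$ is the least reflexive and transitive relation on such trees with $(A*B)*C \le A*(B*C)$ and monotone in each argument of $*$. The application tree is defined by $\alpha[x]=x$, $\alpha[M(N)]=\alpha[M]*\alpha[N]$, $\alpha[\lambda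 x.M]=\alpha[M]$. The binding forest $\gamma^F[M]$ of an indecomposable planar term $M$ with $k\ge 1$ free variables is a list of $k$ leaf-labelled binary trees defined inductively by: $\gamma^F[x] = x$; $\gamma^F[M(N)] = \gamma^F[M],\gamma^F[N]$ (concatenation); $\gamma^F[\lambda x.M] = A*B,\Gamma$ where $\gamma^F[M] = A,B,\Gamma$ with $x$ at the rightmost end of $\mathrm{fr}(A)$ (this last condition always holds for planar terms). The binding tree of a closed indecomposable planar term $\lambda x.M$ is the single tree $\gamma^T[\lambda x.M] = \gamma^F[M]$. -}

module Defs where

open import Data.Bool.Base using (if_then_else_)
open import Data.List.Base using (List; []; _∷_; [_]; _++_; filter; last; length)
open import Data.List.Membership.Propositional using (_∈_)
open import Data.List.Relation.Binary.Disjoint.Propositional using (Disjoint)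
open import Data.List.Relation.Unary.Unique.Propositional using (Unique)
open import Data.Maybe.Base using (Maybe; just; nothing; zipWith; _>>=_)
open import Data.Maybe.Properties using (≡-dec)
open import Data.Nat.Base using (ℕ)
open import Data.Nat.Properties using (_≟_)
open import Data.Product.Base using (_×_)
open import Relation.Binary.PropositionalEquality using (_≡_; _≢_)
open import Relation.Nullary.Decidable.Core using (does; ¬?)
open import Relation.Nullary.Negation.Core using (¬_)

Var : Set
Var = ℕ

Word : Set
Word = List Var

occurrences : Var → Word → ℕ
occurrences x w = length (filter (x ≟_) w)

-- Raw named terms.  The quotient by α-conversion is rendered by working with
-- all representatives that satisfy the predicate WellNamed below.
data Term : Set where
  var  : Var → Term
  _·_  : Term → Term → Term
  ƛ_⇒_ : Var → Term → Term

infixl 7 _·_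
infixr 5 ƛ_⇒_

-- Free variables with multiplicity: one entry for each free occurrence, from
-- left to right.
fv : Term → Word
fv (var x)   = [ x ]
fv (M · N)   = fv M ++ fv N
fv (ƛ x ⇒ M) = filter (λ y → ¬? (x ≟ y)) (fv M)

-- Bound variables, one entry for each abstraction.
bv : Term → Word
bv (var x)   = []
bv (M · N)   = bv M ++ bv N
bv (ƛ x ⇒ M) = x ∷ bv M

WellNamed : Term → Set
WellNamed M = Unique (bv M) × Disjoint (fv M) (bv M)

infix 4 _⊑_

data _⊑_ : Term → Term → Set where
  ⊑-refl : ∀ {M} → M ⊑ M
  ⊑-fun  : ∀ {P M N} → P ⊑ M → P ⊑ M · N
  ⊑-arg  : ∀ {P M N} → P ⊑ N → P ⊑ M · N
  ⊑-body : ∀ {P x M} → P ⊑ M → P ⊑ ƛ x ⇒ M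

Closed : Term → Set
Closed M = fv M ≡ []

Indecomposable : Term → Set
Indecomposable M = ∀ N → N ⊑ M → N ≢ M → ¬ Closed N

Linear : Term → Set
Linear M = (∀ x N → (ƛ x ⇒ N) ⊑ M → occurrences x (fv N) ≡ 1)
         × (∀ x → x ∈ fv M → occurrences x (fv M) ≡ 1)

γ : Term → Word
γ (var x)   = [ x ]
γ (M · N)   = γ M ++ γ N
γ (ƛ x ⇒ M) = x ∷ γ M

DoubleOccurrence : Word → Set
DoubleOccurrence w = ∀ x → x ∈ w → occurrences x w ≡ 2

record Planar (M : Term) : Set where
  field
    linear : Linear M
    nested : ∀ x δ u v → γ M ≡ u ++ (x ∷ δ ++ [ x ]) ++ v → DoubleOccurrence δ

data Tree : Set where
  leaf : Var → Tree
  _*_  : Tree → Tree → Tree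

infixl 7 _*_

fr : Tree → Word
fr (leaf x) = [ x ]
fr (A * B)  = fr A ++ fr B

infix 4 _≤_

-- The Tamari order.
data _≤_ : Tree → Tree → Set where
  ≤-refl  : ∀ {A} → A ≤ A
  ≤-trans : ∀ {A B C} → A ≤ B → B ≤ C → A ≤ C
  ≤-assoc : ∀ {A B C} → (A * B) * C ≤ A * (B * C)
  ≤-monoˡ : ∀ {A A′ B} → A ≤ A′ → A * B ≤ A′ * B
  ≤-monoʳ : ∀ {A B B′} → B ≤ B′ → A * B ≤ A * B′

α : Term → Tree
α (var x)   = leaf x
α (M · N)   = α M * α N
α (ƛ x ⇒ M) = α M

-- The abstraction case of the binding forest, undefined unless the forest has
-- the form A , B , Γ with x at the rightmost end of fr A.
bind : Var → List Tree → Maybe (List Tree)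
bind x (A ∷ B ∷ Γ) =
  if does (≡-dec _≟_ (last (fr A)) (just x)) then just (A * B ∷ Γ) else nothing
bind x _           = nothing

-- Binding forest, as a partial function on all terms.
γF : Term → Maybe (List Tree)
γF (var x)   = just [ leaf x ]
γF (M · N)   = zipWith _++_ (γF M) (γF N)
γF (ƛ x ⇒ M) = γF M >>= bind x

single : List Tree → Maybe Tree
single (T ∷ []) = just T
single _        = nothing

-- Binding tree, intended for closed terms, as a partial function on all terms.
γT : Term → Maybe Tree
γT (ƛ x ⇒ M) = γF M >>= single
γT _         = nothing

{-# OPTIONS --safe #-}
module Submission where

-- The inequality is proved for forests.  If the forest of M is A₁ , … , Aₖ,
-- then the left comb (…((A₁ * A₂) * A₃)…) * Aₖ lies below α M.  Abstraction
-- replaces A₁ , A₂ by A₁ * A₂, which leaves the left comb unchanged, just as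
-- α ignores the binder.  For an application, the left comb of a concatenation
-- lies below the product of the two left combs, by repeated use of
-- (A * B) * C ≤ A * (B * C) (leftComb-≤).  When k = 1 the left comb is the
-- only tree of the forest.
--
-- That the forest is defined rests on two facts.  In a planar term, the
-- variable bound by ƛ x ⇒ N is the first free variable of N (binds-first):
-- a free variable of N to the left of x would occur only once between the
-- binder x and its occurrence.  Moreover, the rightmost labels of the trees in
-- the forest of M are the free variables of M in order (ForestBelow.ends).  So
-- the first tree of the forest of N ends in x, and a second tree exists if
-- ƛ x ⇒ N is not closed.

open import Defs
open import Data.List.Base
  using (List; []; _∷_; [_]; _++_; map; foldl; filter; last; length)
open import Data.List.Membership.Propositional using (_∈_; _∉_)
open import Data.List.Membership.Propositional.Properties
  using (∈-filter⁺; ∈-length; ∈-∃++; ∈-++⁺ˡ; ∈-++⁺ʳ)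
open import Data.List.Properties
  using (∷-injectiveˡ; ∷-injectiveʳ; ++-assoc; ++-identityʳ; ++-conicalˡ; map-++; foldl-++; filter-all;
         filter-accept; filter-reject; filter-++; length-++)
open import Data.List.Relation.Binary.Sublist.Propositional
  using (_⊆_; []; _∷_; _∷ʳ_; ⊆-refl; ⊆-trans; lookup)
open import Data.List.Relation.Binary.Sublist.Propositional.Properties
  using (++⁺; ++⁺ˡ; ++⁺ʳ; All-resp-⊆; filter-⊆; filter⁺; length-mono-≤)
open import Data.List.Relation.Unary.All.Properties using (¬Any⇒All¬; All¬⇒¬Any)
open import Data.List.Relation.Unary.AllPairs using ([]; _∷_)
open import Data.List.Relation.Unary.Any using (here; there)
open import Data.List.Relation.Unary.Unique.Propositional using (Unique)
open import Data.Maybe.Base using (just; zipWith; _>>=_)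
open import Data.Maybe.Properties using (≡-dec)
import Data.Nat.Base as ℕ
import Data.Nat.Properties as ℕ
open import Data.Nat.Properties using (_≟_)
open import Data.Product.Base using (∃-syntax; _×_; _,_; proj₁; proj₂)
open import Function.Base using (_∘_)
open import Relation.Binary.PropositionalEquality
  using (_≡_; _≢_; refl; sym; trans; cong; cong₂; subst; subst₂; module ≡-Reasoning)
open import Relation.Nullary.Decidable using (yes; no; ¬?; dec-true)
open import Relation.Nullary.Negation using (¬_; contradiction)

-- Words

Unique-resp-⊆ : ∀ {v w : Word} → v ⊆ w → Unique w → Unique v
Unique-resp-⊆ []          []       = []
Unique-resp-⊆ (_ ∷ʳ v⊆w)  (_ ∷ u)  = Unique-resp-⊆ v⊆w u
Unique-resp-⊆ (refl ∷ v⊆w) (p ∷ u) = All-resp-⊆ v⊆w p ∷ Unique-resp-⊆ v⊆w u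

⊆-uncons : ∀ {y} {ys w : Word} → y ∷ ys ⊆ w →
           ∃[ p ] ∃[ q ] (w ≡ p ++ y ∷ q × ys ⊆ q)
⊆-uncons (refl ∷ s) = [] , _ , refl , s
⊆-uncons (z ∷ʳ s) with p , q , refl , t ← ⊆-uncons s = z ∷ p , q , refl , t

occurrences-mono : ∀ x {v w} → v ⊆ w → occurrences x v ℕ.≤ occurrences x w
occurrences-mono x v⊆w =
  length-mono-≤ (filter⁺ (x ≟_) (x ≟_) (λ { refl p → p }) v⊆w)

∈⇒occurrences>0 : ∀ {x w} → x ∈ w → 0 ℕ.< occurrences x w
∈⇒occurrences>0 {x} x∈w = ∈-length (∈-filter⁺ (x ≟_) x∈w refl)

occurrences>0⇒∈ : ∀ {x} w → 0 ℕ.< occurrences x w → x ∈ w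
occurrences>0⇒∈ {x} (y ∷ w) p with x ≟ y
... | yes x≡y = here x≡y
... | no  x≢y = there (occurrences>0⇒∈ w
                  (subst (0 ℕ.<_) (cong length (filter-reject (x ≟_) x≢y)) p))

occurrences-here : ∀ x w → occurrences x (x ∷ w) ≡ ℕ.suc (occurrences x w)
occurrences-here x w = cong length (filter-accept (x ≟_) refl)

occurrences-skip : ∀ {x y} w → y ≢ x → occurrences y (x ∷ w) ≡ occurrences y w
occurrences-skip {y = y} w y≢x = cong length (filter-reject (y ≟_) y≢x)

occurrences-++ : ∀ x v w → occurrences x (v ++ w) ≡ occurrences x v ℕ.+ occurrences x w
occurrences-++ x v w = trans (cong length (filter-++ (x ≟_) v w)) (length-++ (filter (x ≟_) v))

occurrences-delete : ∀ {x y} → x ≢ y → ∀ w →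
  occurrences y (filter (λ z → ¬? (x ≟ z)) w) ≡ occurrences y w
occurrences-delete x≢y [] = refl
occurrences-delete {x} {y} x≢y (z ∷ w) with x ≟ z
... | yes refl = begin
  occurrences y (filter (λ u → ¬? (x ≟ u)) (x ∷ w))
    ≡⟨ cong (occurrences y) (filter-reject (λ u → ¬? (x ≟ u)) (λ x≢x → x≢x refl)) ⟩
  occurrences y (filter (λ u → ¬? (x ≟ u)) w)  ≡⟨ occurrences-delete x≢y w ⟩
  occurrences y w                              ≡⟨ occurrences-skip w (x≢y ∘ sym) ⟨
  occurrences y (x ∷ w)                        ∎
  where open ≡-Reasoning
... | no x≢z = begin
  occurrences y (filter (λ u → ¬? (x ≟ u)) (z ∷ w))
    ≡⟨ cong (occurrences y) (filter-accept (λ u → ¬? (x ≟ u)) x≢z) ⟩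
  occurrences y ([ z ] ++ filter (λ u → ¬? (x ≟ u)) w)
    ≡⟨ occurrences-++ y [ z ] (filter (λ u → ¬? (x ≟ u)) w) ⟩
  occurrences y [ z ] ℕ.+ occurrences y (filter (λ u → ¬? (x ≟ u)) w)
    ≡⟨ cong (occurrences y [ z ] ℕ.+_) (occurrences-delete x≢y w) ⟩
  occurrences y [ z ] ℕ.+ occurrences y w      ≡⟨ occurrences-++ y [ z ] w ⟨
  occurrences y (z ∷ w)                        ∎
  where open ≡-Reasoning

last-++ : ∀ v {w : Word} {y} → last w ≡ just y → last (v ++ w) ≡ just y
last-++ []      eq = eq
last-++ (x ∷ v) {w} eq = last-∷ (v ++ w) (last-++ v eq)
  where
  last-∷ : ∀ {x y} (w : Word) → last w ≡ just y → last (x ∷ w) ≡ just y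
  last-∷ (_ ∷ _) eq = eq

-- Free variables and binding diagrams

-- Every free variable occurs exactly once: the second half of linearity.
FreeOnce : Term → Set
FreeOnce M = ∀ x → x ∈ fv M → occurrences x (fv M) ≡ 1

freeOnce-⊆ : ∀ M N → fv N ⊆ fv M → FreeOnce M → FreeOnce N
freeOnce-⊆ M N s once x x∈ = ℕ.≤-antisym
  (subst (_ ℕ.≤_) (once x (lookup s x∈)) (occurrences-mono x s))
  (∈⇒occurrences>0 x∈)

freeOnce-body : ∀ {x N} → Linear (ƛ x ⇒ N) → FreeOnce N
freeOnce-body {x} {N} (bound , free) y y∈ with x ≟ y
... | yes refl = bound x N ⊑-refl
... | no  x≢y  = trans (sym (occurrences-delete x≢y (fv N)))
                       (free y (∈-filter⁺ (λ z → ¬? (x ≟ z)) y∈ x≢y))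

fv⊆γ : ∀ M → fv M ⊆ γ M
fv⊆γ (var x)   = ⊆-refl
fv⊆γ (M · N)   = ++⁺ (fv⊆γ M) (fv⊆γ N)
fv⊆γ (ƛ x ⇒ M) = x ∷ʳ ⊆-trans (filter-⊆ (λ y → ¬? (x ≟ y)) (fv M)) (fv⊆γ M)

occurrences-γ : ∀ {y} M → y ∉ bv M → occurrences y (γ M) ≡ occurrences y (fv M)
occurrences-γ (var x) _ = refl
occurrences-γ {y} (M · N) y∉ = begin
  occurrences y (γ M ++ γ N)                     ≡⟨ occurrences-++ y (γ M) (γ N) ⟩
  occurrences y (γ M) ℕ.+ occurrences y (γ N)    ≡⟨ cong₂ ℕ._+_
                                                      (occurrences-γ M (y∉ ∘ ∈-++⁺ˡ))
                                                      (occurrences-γ N (y∉ ∘ ∈-++⁺ʳ (bv M))) ⟩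
  occurrences y (fv M) ℕ.+ occurrences y (fv N)  ≡⟨ occurrences-++ y (fv M) (fv N) ⟨
  occurrences y (fv M ++ fv N)                   ∎
  where open ≡-Reasoning
occurrences-γ {y} (ƛ x ⇒ M) y∉ = begin
  occurrences y (x ∷ γ M)         ≡⟨ occurrences-skip (γ M) (y∉ ∘ here) ⟩
  occurrences y (γ M)             ≡⟨ occurrences-γ M (y∉ ∘ there) ⟩
  occurrences y (fv M)            ≡⟨ occurrences-delete (y∉ ∘ here ∘ sym) (fv M) ⟨
  occurrences y (fv (ƛ x ⇒ M))    ∎
  where open ≡-Reasoning

⊑⇒γ-⊆ : ∀ {N M} → N ⊑ M → γ N ⊆ γ M
⊑⇒γ-⊆ ⊑-refl                = ⊆-refl
⊑⇒γ-⊆ (⊑-fun {N = N} N⊑M)   = ++⁺ʳ (γ N) (⊑⇒γ-⊆ N⊑M)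
⊑⇒γ-⊆ (⊑-arg {M = M} N⊑M)   = ++⁺ˡ (γ M) (⊑⇒γ-⊆ N⊑M)
⊑⇒γ-⊆ (⊑-body {x = x} N⊑M)  = x ∷ʳ ⊑⇒γ-⊆ N⊑M

-- The binding diagram of an abstraction is longer than that of its body.
body-≢ : ∀ {P x M} → P ⊑ M → P ≢ ƛ x ⇒ M
body-≢ P⊑M refl = ℕ.1+n≰n (length-mono-≤ (⊑⇒γ-⊆ P⊑M))

-- Inheritance by immediate subterms

wellNamed-⊆ : ∀ M N → fv N ⊆ fv M → bv N ⊆ bv M → WellNamed M → WellNamed N
wellNamed-⊆ _ _ f b (u , d) =
  Unique-resp-⊆ b u , λ (x∈fv , x∈bv) → d (lookup f x∈fv , lookup b x∈bv)

wellNamed-body : ∀ {x} N → WellNamed (ƛ x ⇒ N) → WellNamed N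
wellNamed-body {x} N (x≢bv ∷ u , d) = u , disjoint
  where
  disjoint : ∀ {y} → ¬ (y ∈ fv N × y ∈ bv N)
  disjoint {y} (y∈fv , y∈bv) with x ≟ y
  ... | yes refl = All¬⇒¬Any x≢bv y∈bv
  ... | no  x≢y  = d (∈-filter⁺ (λ z → ¬? (x ≟ z)) y∈fv x≢y , there y∈bv)

-- Nestedness and linearity of bound variables pass to any subterm whose diagram
-- is a factor of that of M; FreeOnce is a separate premise because variables
-- bound in M may be free in N.
planar-⊑ : ∀ {M N} l r → (∀ {P} → P ⊑ N → P ⊑ M) → γ M ≡ l ++ γ N ++ r →
           FreeOnce N → Planar M → Planar N
planar-⊑ {M} {N} l r sub γM≡ once planar = record
  { linear = (λ x P P⊑N → proj₁ linear x P (sub P⊑N)) , once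
  ; nested = λ x δ u v γN≡ →
      nested x δ (l ++ u) (v ++ r) (reassociate (x ∷ δ ++ [ x ]) u v γN≡)
  }
  where
  open Planar planar
  open ≡-Reasoning
  reassociate : ∀ w u v → γ N ≡ u ++ w ++ v → γ M ≡ (l ++ u) ++ w ++ (v ++ r)
  reassociate w u v γN≡ = begin
    γ M                        ≡⟨ γM≡ ⟩
    l ++ γ N ++ r              ≡⟨ cong (λ z → l ++ z ++ r) γN≡ ⟩
    l ++ (u ++ w ++ v) ++ r    ≡⟨ cong (l ++_) (++-assoc u (w ++ v) r) ⟩
    l ++ u ++ (w ++ v) ++ r    ≡⟨ cong (λ z → l ++ u ++ z) (++-assoc w v r) ⟩
    l ++ u ++ w ++ v ++ r      ≡⟨ ++-assoc l u (w ++ v ++ r) ⟨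
    (l ++ u) ++ w ++ v ++ r    ∎

planar-body : ∀ {x N} → Planar (ƛ x ⇒ N) → Planar N
planar-body {x} {N} planar =
  planar-⊑ [ x ] [] ⊑-body (cong (x ∷_) (sym (++-identityʳ (γ N))))
    (freeOnce-body (Planar.linear planar)) planar

-- The hypotheses of the induction: unlike indecomposability, the last
-- condition also excludes that M itself is closed.
record Admissible (M : Term) : Set where
  field
    wellNamed : WellNamed M
    planar    : Planar M
    open-⊑    : ∀ N → N ⊑ M → ¬ Closed N

admissible-fun : ∀ {M N} → Admissible (M · N) → Admissible M
admissible-fun {M} {N} adm = record
  { wellNamed = wellNamed-⊆ (M · N) M fv⊆ (++⁺ʳ (bv N) ⊆-refl) wellNamed
  ; planar    = planar-⊑ [] (γ N) ⊑-fun refl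
                  (freeOnce-⊆ (M · N) M fv⊆ (proj₂ (Planar.linear planar))) planar
  ; open-⊑    = λ P → open-⊑ P ∘ ⊑-fun
  }
  where
  open Admissible adm
  fv⊆ : fv M ⊆ fv M ++ fv N
  fv⊆ = ++⁺ʳ (fv N) ⊆-refl

admissible-arg : ∀ {M N} → Admissible (M · N) → Admissible N
admissible-arg {M} {N} adm = record
  { wellNamed = wellNamed-⊆ (M · N) N fv⊆ (++⁺ˡ (bv M) ⊆-refl) wellNamed
  ; planar    = planar-⊑ (γ M) [] ⊑-arg (cong (γ M ++_) (sym (++-identityʳ (γ N))))
                  (freeOnce-⊆ (M · N) N fv⊆ (proj₂ (Planar.linear planar))) planar
  ; open-⊑    = λ P → open-⊑ P ∘ ⊑-arg
  }
  where
  open Admissible adm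
  fv⊆ : fv N ⊆ fv M ++ fv N
  fv⊆ = ++⁺ˡ (fv M) ⊆-refl

admissible-body : ∀ {x N} → Admissible (ƛ x ⇒ N) → Admissible N
admissible-body {N = N} adm = record
  { wellNamed = wellNamed-body N wellNamed
  ; planar    = planar-body planar
  ; open-⊑    = λ P → open-⊑ P ∘ ⊑-body
  }
  where open Admissible adm

-- Planar abstractions bind the first free variable

fv-ƛ : ∀ {x ys} N → fv N ≡ x ∷ ys → occurrences x (fv N) ≡ 1 → fv (ƛ x ⇒ N) ≡ ys
fv-ƛ {x} {ys} N fvN≡ once = begin
  filter (λ y → ¬? (x ≟ y)) (fv N)      ≡⟨ cong (filter (λ y → ¬? (x ≟ y))) fvN≡ ⟩
  filter (λ y → ¬? (x ≟ y)) (x ∷ ys)    ≡⟨ filter-reject (λ y → ¬? (x ≟ y)) (λ x≢x → x≢x refl) ⟩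
  filter (λ y → ¬? (x ≟ y)) ys          ≡⟨ filter-all (λ y → ¬? (x ≟ y)) (¬Any⇒All¬ ys x∉ys) ⟩
  ys                                    ∎
  where
  open ≡-Reasoning
  1+occ≡1 : ℕ.suc (occurrences x ys) ≡ 1
  1+occ≡1 = trans (sym (occurrences-here x ys)) (trans (cong (occurrences x) (sym fvN≡)) once)
  x∉ys : x ∉ ys
  x∉ys x∈ys = ℕ.<-irrefl (sym (ℕ.suc-injective 1+occ≡1)) (∈⇒occurrences>0 x∈ys)

binds-first : ∀ {x N} → WellNamed (ƛ x ⇒ N) → Planar (ƛ x ⇒ N) →
              fv N ≡ x ∷ fv (ƛ x ⇒ N)
binds-first {x} {N} named planar = head (fv N) refl x∈fvN
  where
  open Planar planar
  once : FreeOnce N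
  once = freeOnce-body linear

  x-once : occurrences x (fv N) ≡ 1
  x-once = proj₁ linear x N ⊑-refl

  x∈fvN : x ∈ fv N
  x∈fvN = occurrences>0⇒∈ (fv N) (subst (0 ℕ.<_) (sym x-once) (ℕ.s≤s ℕ.z≤n))

  γ-once : ∀ {y} → y ∈ fv N → occurrences y (γ N) ≡ 1
  γ-once y∈ = trans (occurrences-γ N λ y∈bv → proj₂ (wellNamed-body N named) (y∈ , y∈bv))
                    (once _ y∈)

  -- With δ = p , y , q₁ between the binder x and an occurrence of x, planarity
  -- would make y occur twice in δ, hence in γ N.
  not-before : ∀ {y ys} → fv N ≡ y ∷ ys → x ∉ ys
  not-before {y} {ys} fvN≡ x∈ys
    with p , q , γN≡ , ys⊆q ← ⊆-uncons (subst (_⊆ γ N) fvN≡ (fv⊆γ N))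
    with q₁ , q₂ , refl ← ∈-∃++ (lookup ys⊆q x∈ys) =
    ℕ.1+n≰n (subst₂ ℕ._≤_ (nested x δ [] q₂ (cong (x ∷_) γN≡δxq₂) y (∈-++⁺ʳ p (here refl)))
                          (γ-once (subst (y ∈_) (sym fvN≡) (here refl)))
                          (occurrences-mono y δ⊆γN))
    where
    δ : Word
    δ = p ++ y ∷ q₁
    γN≡δxq₂ : γ N ≡ (δ ++ [ x ]) ++ q₂
    γN≡δxq₂ = trans γN≡ (trans (sym (++-assoc p (y ∷ q₁) (x ∷ q₂))) (sym (++-assoc δ [ x ] q₂)))
    δ⊆γN : δ ⊆ γ N
    δ⊆γN = subst (δ ⊆_) (sym γN≡δxq₂) (++⁺ʳ q₂ (++⁺ʳ [ x ] ⊆-refl))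

  head : ∀ w → fv N ≡ w → x ∈ w → fv N ≡ x ∷ fv (ƛ x ⇒ N)
  head (_ ∷ ys) fvN≡ (here refl)  = trans fvN≡ (cong (x ∷_) (sym (fv-ƛ N fvN≡ x-once)))
  head (_ ∷ ys) fvN≡ (there x∈ys) = contradiction x∈ys (not-before fvN≡)

-- Binding forests

-- (…((A * B₁) * B₂)…) * Bₖ
leftComb : Tree → List Tree → Tree
leftComb = foldl _*_

leftComb-≤ : ∀ {A B C} Γ → C ≤ A * B → leftComb C Γ ≤ A * leftComb B Γ
leftComb-≤ []      C≤AB = C≤AB
leftComb-≤ (D ∷ Γ) C≤AB = leftComb-≤ Γ (≤-trans (≤-monoˡ C≤AB) ≤-assoc)

-- M has a nonempty binding forest, whose trees end in the successive free
-- variables of M and whose left comb lies below the application tree.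
record ForestBelow (M : Term) : Set where
  field
    first   : Tree
    rest    : List Tree
    defined : γF M ≡ just (first ∷ rest)
    ends    : map (last ∘ fr) (first ∷ rest) ≡ map just (fv M)
    below   : leftComb first rest ≤ α M

bind-just : ∀ {x A} B Γ → last (fr A) ≡ just x → bind x (A ∷ B ∷ Γ) ≡ just (A * B ∷ Γ)
bind-just {x} {A} B Γ eq rewrite dec-true (≡-dec _≟_ (last (fr A)) (just x)) eq = refl

forest-· : ∀ {M N} → ForestBelow M → ForestBelow N → ForestBelow (M · N)
forest-· {M} {N} F G = record
  { first   = F.first
  ; rest    = F.rest ++ G.first ∷ G.rest
  ; defined = cong₂ (zipWith _++_) F.defined G.defined
  ; ends    = trans (map-++ (last ∘ fr) (F.first ∷ F.rest) (G.first ∷ G.rest))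
                (trans (cong₂ _++_ F.ends G.ends) (sym (map-++ just (fv M) (fv N))))
  ; below   = subst (_≤ α M * α N)
                (sym (foldl-++ _*_ F.first F.rest (G.first ∷ G.rest)))
                (≤-trans (leftComb-≤ G.rest ≤-refl)
                  (≤-trans (≤-monoˡ F.below) (≤-monoʳ G.below)))
  }
  where
  module F = ForestBelow F
  module G = ForestBelow G

forest-ƛ : ∀ {x N} → fv N ≡ x ∷ fv (ƛ x ⇒ N) → ¬ Closed (ƛ x ⇒ N) →
           ForestBelow N → ForestBelow (ƛ x ⇒ N)
forest-ƛ {x} {N} fvN≡ ¬closed
  record { first = A ; rest = Γ ; defined = defined ; ends = ends ; below = below } =
  extend Γ (fv (ƛ x ⇒ N)) refl defined (trans ends (cong (map just) fvN≡)) below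
  where
  extend : ∀ Γ ys → fv (ƛ x ⇒ N) ≡ ys → γF N ≡ just (A ∷ Γ) →
           map (last ∘ fr) (A ∷ Γ) ≡ just x ∷ map just ys →
           leftComb A Γ ≤ α N → ForestBelow (ƛ x ⇒ N)
  extend Γ       []       closed _ _ _ = contradiction closed ¬closed
  extend []      (y ∷ ys) _ _ () _
  extend (B ∷ Γ) (y ∷ ys) fv≡ defined ends below = record
    { first   = A * B
    ; rest    = Γ
    ; defined = trans (cong (_>>= bind x) defined) (bind-just B Γ (∷-injectiveˡ ends))
    ; ends    = trans (cong₂ _∷_ (last-++ (fr A) (∷-injectiveˡ (∷-injectiveʳ ends)))
                                 (∷-injectiveʳ (∷-injectiveʳ ends)))
                      (cong (map just) (sym fv≡))
    ; below   = below
    }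

forest : ∀ M → Admissible M → ForestBelow M
forest (var x) _ = record
  { first = leaf x ; rest = [] ; defined = refl ; ends = refl ; below = ≤-refl }
forest (M · N) adm = forest-· (forest M (admissible-fun adm)) (forest N (admissible-arg adm))
forest (ƛ x ⇒ N) adm =
  forest-ƛ (binds-first wellNamed planar) (open-⊑ _ ⊑-refl) (forest N (admissible-body adm))
  where open Admissible adm

mainTheorem6 : ∀ (M : Term) → WellNamed M → Closed M → Indecomposable M → Planar M → ∃[ T ] (γT M ≡ just T × T ≤ α M)
mainTheorem6 (M · N) _ closed indec _ =
  contradiction (++-conicalˡ (fv M) (fv N) closed) (indec M (⊑-fun ⊑-refl) λ ())
mainTheorem6 (ƛ x ⇒ N) named closed indec planar =
  tree (forest N body) (trans (binds-first named planar) (cong (x ∷_) closed))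
  where
  body : Admissible N
  body = record
    { wellNamed = wellNamed-body N named
    ; planar    = planar-body planar
    ; open-⊑    = λ P P⊑N → indec P (⊑-body P⊑N) (body-≢ P⊑N)
    }
  -- Since N has a single free variable, its forest is a single tree.
  tree : ForestBelow N → fv N ≡ [ x ] → ∃[ T ] (γT (ƛ x ⇒ N) ≡ just T × T ≤ α N)
  tree record { first = A ; rest = Γ ; defined = defined ; ends = ends ; below = below } fvN≡ =
    only Γ defined (trans ends (cong (map just) fvN≡)) below
    where
    only : ∀ Γ → γF N ≡ just (A ∷ Γ) → map (last ∘ fr) (A ∷ Γ) ≡ [ just x ] →
           leftComb A Γ ≤ α N → ∃[ T ] (γT (ƛ x ⇒ N) ≡ just T × T ≤ α N)
    only [] defined _ below = A , cong (_>>= single) defined , below
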